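{- Let $G$ be a connected bipartite graph with bipartition $(X,Y)$, and let $n\geq 6$ be an even integer. Then $G\times C_n$ has exactly two connected components, which are isomorphic. If $|X|\geq\delta(G)+1$, $|Y|\geq\delta(G)+1$ and $\kappa(G)>\frac{4}{n}\delta(G)$, then both connected components of $G\times C_{n}$ are super-$\kappa$.
   Context: All graphs are simple. $C_n$ is the cycle on $n$ vertices. The direct product $G\times H$ has vertex set $V(G)\times V(H)$, with $(u_1,v_1)(u_2,v_2)$ an edge iff $u_1u_2\in E(G)$ and $v_1v_2\in E(H)$. $\delta(G)$ is the minimum degree. For a non-complete graph $G$, the connectivity $\kappa(G)$ is the minimum size of a vertex set $S$ such that $G-S$ is disconnected; for a complete graph $\kappa(G)=|V(G)|-1$. A graph is super connected (super-$\kappa$) if every minimum vertex cut is the neighborhood of some vertex of minimum degree.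
   Formalization: G is assumed to have at least one edge (G is finite, as usual): for the single-vertex graph, which is connected and bipartite, G×C_n consists of n isolated vertices, so it does not have exactly two components. -}

module Defs where

open import Data.Nat using (ℕ; zero; suc; _≤_; _+_; s≤s; _≤?_)
open import Data.Nat.Properties using (1+n≢n; _≟_)
open import Data.Fin using (Fin; toℕ)
open import Data.Bool using (Bool; true; false)
open import Data.Product using (Σ; _×_; _,_; proj₁; proj₂)
open import Data.Sum using (_⊎_; inj₁; inj₂)
open import Data.List using (List; length)
open import Data.List.Membership.Propositional using (_∈_)
open import Data.List.Relation.Unary.Unique.Propositional using (Unique)
open import Relation.Nullary using (¬_; Dec)
open import Relation.Nullary.Decidable.Core using (_×-dec_; _⊎-dec_)
open import Relation.Binary.PropositionalEquality using (_≡_; _≢_; refl; sym; trans; subst; cong)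
open import Function.Bundles using (_↔_; Inverse)

record Graph : Set₁ where
  field
    V       : Set
    Adj     : V → V → Set
    adj?    : ∀ u v → Dec (Adj u v)
    sym-adj : ∀ {u v} → Adj u v → Adj v u
    irrefl  : ∀ {v} → ¬ Adj v v
open Graph public

Finite : Graph → Set
Finite G = Σ ℕ λ m → V G ↔ Fin m

HasSize : {A : Set} → (A → Set) → ℕ → Set
HasSize {A} P k =
  Σ (List A) λ L → Unique L × (∀ a → (a ∈ L → P a) × (P a → a ∈ L)) × length L ≡ k

data Reach (G : Graph) : V G → V G → Set where
  here : ∀ {v} → Reach G v v
  step : ∀ {u w v} → Adj G u w → Reach G w v → Reach G u v

data ReachIn (G : Graph) (P : V G → Set) : V G → V G → Set where
  here : ∀ {v} → P v → ReachIn G P v v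
  step : ∀ {u w v} → P u → Adj G u w → ReachIn G P w v → ReachIn G P u v

Connected : Graph → Set
Connected G = ∀ u v → Reach G u v

IsComponentOf : (G : Graph) → V G → (V G → Bool) → Set
IsComponentOf G a C = ∀ w → (C w ≡ true → Reach G a w) × (Reach G a w → C w ≡ true)

_[_] : (G : Graph) → (V G → Bool) → Graph
G [ C ] = record
  { V       = Σ (V G) (λ v → C v ≡ true)
  ; Adj     = λ u v → Adj G (proj₁ u) (proj₁ v)
  ; adj?    = λ u v → adj? G (proj₁ u) (proj₁ v)
  ; sym-adj = sym-adj G
  ; irrefl  = irrefl G
  }

Degree : (G : Graph) → V G → ℕ → Set
Degree G v d = HasSize (Adj G v) d

MinDegree : Graph → ℕ → Set
MinDegree G d = (Σ (V G) λ v → Degree G v d) × (∀ v e → Degree G v e → d ≤ e)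

-- Vertex cuts, connectivity, super-κ
-- Vertex sets are represented as duplicate-free lists (so |S| = length S).

IsVertexCut : (G : Graph) → List (V G) → Set
IsVertexCut G S = Unique S ×
  (Σ (V G) λ u → Σ (V G) λ w → ¬ (u ∈ S) × ¬ (w ∈ S) × ¬ ReachIn G (λ x → ¬ (x ∈ S)) u w)

Complete : Graph → Set
Complete G = ∀ u v → u ≢ v → Adj G u v

IsMinVertexCut : (G : Graph) → List (V G) → Set
IsMinVertexCut G S = IsVertexCut G S ×
  (∀ (T : List (V G)) → IsVertexCut G T → length S ≤ length T)

-- κ(G) = k   (for complete G: k = |V(G)| - 1)
Connectivity : Graph → ℕ → Set
Connectivity G k =
  (Complete G → HasSize {V G} (λ _ → V G) (suc k)) ×
  (¬ Complete G → (Σ (List (V G)) λ S → IsVertexCut G S × length S ≡ k) ×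
                  (∀ (T : List (V G)) → IsVertexCut G T → k ≤ length T))

SuperKappa : Graph → Set
SuperKappa G = ∀ (S : List (V G)) → IsMinVertexCut G S →
  Σ (V G) λ v → (Σ ℕ λ d → Degree G v d × MinDegree G d) ×
                (∀ u → (u ∈ S → Adj G v u) × (Adj G v u → u ∈ S))

_≅_ : Graph → Graph → Set
G ≅ H = Σ (V G ↔ V H) λ f →
  ∀ u v → (Adj G u v → Adj H (Inverse.to f u) (Inverse.to f v)) ×
          (Adj H (Inverse.to f u) (Inverse.to f v) → Adj G u v)

-- Bipartition: X v = true means v ∈ X, X v = false means v ∈ Y

IsBipartition : (G : Graph) → (V G → Bool) → Set
IsBipartition G X = ∀ u v → Adj G u v → X u ≢ X v

_×ᵍ_ : Graph → Graph → Graph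
G ×ᵍ H = record
  { V       = V G × V H
  ; Adj     = λ p q → Adj G (proj₁ p) (proj₁ q) × Adj H (proj₂ p) (proj₂ q)
  ; adj?    = λ p q → adj? G (proj₁ p) (proj₁ q) ×-dec adj? H (proj₂ p) (proj₂ q)
  ; sym-adj = λ (a , b) → sym-adj G a , sym-adj H b
  ; irrefl  = λ (a , _) → irrefl G a
  }

Succ : (n : ℕ) → Fin n → Fin n → Set
Succ n i j = (toℕ j ≡ suc (toℕ i)) ⊎ (3 ≤ n × suc (toℕ i) ≡ n × toℕ j ≡ 0)

private
  succ? : ∀ n (i j : Fin n) → Dec (Succ n i j)
  succ? n i j = (toℕ j ≟ suc (toℕ i)) ⊎-dec ((3 ≤? n) ×-dec ((suc (toℕ i) ≟ n) ×-dec (toℕ j ≟ 0)))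

  succ-irrefl : ∀ n (i : Fin n) → ¬ Succ n i i
  succ-irrefl n i (inj₁ e) = 1+n≢n (sym e)
  succ-irrefl n i (inj₂ (h , e , z)) = no31 (subst (λ m → 3 ≤ m) (trans (sym e) (cong suc z)) h)
    where
    no31 : ¬ (3 ≤ 1)
    no31 (s≤s ())

Cycle : ℕ → Graph
Cycle n = record
  { V       = Fin n
  ; Adj     = λ i j → Succ n i j ⊎ Succ n j i
  ; adj?    = λ i j → succ? n i j ⊎-dec succ? n j i
  ; sym-adj = λ { (inj₁ s) → inj₂ s ; (inj₂ s) → inj₁ s }
  ; irrefl  = λ { (inj₁ s) → succ-irrefl n _ s ; (inj₂ s) → succ-irrefl n _ s }
  }

module Submission where

-- The component of G × Cₙ is a cyclic chain of n layers, alternately X and Y, in which any two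
-- consecutive layers span a copy of G.  A minimum cut S has at most 2δ vertices, because
-- neighbourhoods are cuts.  As 4δ < nκ, some two consecutive layers lose fewer than κ vertices to S,
-- so what is left of them is connected; this connectedness passes from a layer to the next one
-- unless S takes at least δ vertices of that layer.  Walking both ways round the cycle one is blocked
-- only if S consists of δ vertices in each of two layers p and q.  If the gap between p and q
-- contains at least two layers, these are untouched by S, hence connected to one another and to the
-- rest through a surviving vertex of layer p.  If it is a single layer, a vertex of it that is cut
-- off is isolated, so S contains its neighbourhood, and equals it by cardinality.

open import Defs
open import Axiom.UniquenessOfIdentityProofs using (module Decidable⇒UIP)
open import Data.Bool as Bool using (Bool; true; false; not; if_then_else_)
open import Data.Bool.Properties using (not-involutive; not-injective; not-¬; ¬-not)
open import Data.Empty using (⊥; ⊥-elim)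
open import Data.Fin as Fin using (Fin; toℕ; opposite)
open import Data.Fin.Properties
  using (toℕ-injective; toℕ<n; toℕ-fromℕ<; opposite-prop; opposite-involutive)
open import Data.List using (List; []; _∷_; _++_; length; map; filter; cartesianProduct; allFin; deduplicate)
open import Data.List.Membership.Propositional using (_∈_; _∉_; find; lose)
open import Data.List.Membership.Propositional.Properties
open import Data.List.Properties using (length-map; length-++; length-filter; filter-notAll)
open import Data.List.Relation.Binary.Subset.Propositional using (_⊆_)
open import Data.List.Relation.Unary.All as All using (All; []; _∷_; all?)
open import Data.List.Relation.Unary.All.Properties using (¬Any⇒All¬; ¬All⇒Any¬)
open import Data.List.Relation.Unary.AllPairs using ([]; _∷_)
open import Data.List.Relation.Unary.Any as Any using (Any; here; there; any?)
open import Data.List.Relation.Unary.Unique.DecPropositional.Properties using (deduplicate-!)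
open import Data.List.Relation.Unary.Unique.Propositional using (Unique)
open import Data.List.Relation.Unary.Unique.Propositional.Properties
  using (filter⁺; map⁺; cartesianProduct⁺; allFin⁺)
open import Data.Nat
open import Data.Nat.Divisibility using (_∣_; divides; ∣n⇒∣m*n)
open import Data.Nat.DivMod
open import Data.Nat.Properties
open import Data.Nat.Tactic.RingSolver using (solve-∀)
open import Data.Product as Product hiding (map)
open import Data.Product.Properties using (≡-dec)
open import Data.Sum using (_⊎_; inj₁; inj₂; [_,_]′)
open import Function using (_∘_)
open import Function.Bundles using (Inverse; mk↔ₛ′)
open import Relation.Binary using (DecidableEquality)
open import Relation.Binary.PropositionalEquality hiding ([_])
open import Relation.Nullary
open import Relation.Nullary.Decidable using (¬?; ⌊_⌋; isYes≗does; dec-true)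
open import Relation.Unary using (Decidable)

-- Counting in duplicate-free lists

module _ {A : Set} (_≟ᴬ_ : DecidableEquality A) where

  open import Data.List.Membership.DecPropositional _≟ᴬ_ using (_∈?_)

  -- Deleting the head `x` from `ys` removes at least one entry, and the tail still lies in what is
  -- left because it avoids `x`.
  unique-⊆⇒length≤ : ∀ {xs ys} → Unique xs → xs ⊆ ys → length xs ≤ length ys
  unique-⊆⇒length≤ {[]} _ _ = z≤n
  unique-⊆⇒length≤ {x ∷ xs} {ys} (x∉ ∷ u) xs⊆ys = ≤-<-trans
    (unique-⊆⇒length≤ u λ z∈ → ∈-filter⁺ ≢x? (xs⊆ys (there z∈)) (All.lookup x∉ z∈ ∘ sym))
    (filter-notAll ≢x? ys (Any.map (λ x≡z z≢x → z≢x (sym x≡z)) (xs⊆ys (here refl))))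
    where
    ≢x? : Decidable (_≢ x)
    ≢x? z = ¬? (z ≟ᴬ x)

  unique-longer⇒∃∉ : ∀ {xs ys} → Unique xs → length ys < length xs → ∃ λ x → x ∈ xs × x ∉ ys
  unique-longer⇒∃∉ {xs} {ys} u lt with any? (λ x → ¬? (x ∈? ys)) xs
  ... | yes found = find found
  ... | no none = contradiction (unique-⊆⇒length≤ u sub) (<⇒≱ lt)
    where
    sub : xs ⊆ ys
    sub {x} x∈ with x ∈? ys
    ... | yes p = p
    ... | no ¬p = contradiction (Any.map (λ { refl → ¬p }) x∈) none

  -- An element of `ys` missing from `xs` could be prepended to `xs`, giving a duplicate-free list
  -- inside `ys` that is too long.
  unique-⊆-long⇒⊇ : ∀ {xs ys} → Unique xs → xs ⊆ ys → length ys ≤ length xs → ys ⊆ xs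
  unique-⊆-long⇒⊇ {xs} {ys} u xs⊆ys le {y} y∈ with y ∈? xs
  ... | yes p = p
  ... | no ¬p = contradiction le (<⇒≱ (unique-⊆⇒length≤ {y ∷ xs} (¬Any⇒All¬ xs ¬p ∷ u)
                  λ { (here refl) → y∈ ; (there z∈) → xs⊆ys z∈ }))

module _ {A : Set} {P Q R : A → Set} (P? : Decidable P) (Q? : Decidable Q) (R? : Decidable R)
         (P⇒R : ∀ {x} → P x → R x) (Q⇒R : ∀ {x} → Q x → R x) (P⇒¬Q : ∀ {x} → P x → ¬ Q x) where

  -- No entry is counted twice on the left, and each one counted there passes `R?`. Applied
  -- repeatedly, this bounds what different layers contain by the length of the whole list.
  length-filter-disjoint : ∀ xs →
    length (filter P? xs) + length (filter Q? xs) ≤ length (filter R? xs)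
  length-filter-disjoint [] = z≤n
  length-filter-disjoint (x ∷ xs) with P? x | Q? x | R? x
  ... | yes p | yes q | _     = contradiction q (P⇒¬Q p)
  ... | yes p | no _  | yes _ = s≤s (length-filter-disjoint xs)
  ... | yes p | no _  | no ¬r = contradiction (P⇒R p) ¬r
  ... | no _  | yes q | yes _ = ≤-trans (≤-reflexive (+-suc _ _)) (s≤s (length-filter-disjoint xs))
  ... | no _  | yes q | no ¬r = contradiction (Q⇒R q) ¬r
  ... | no _  | no _  | yes _ = m≤n⇒m≤1+n (length-filter-disjoint xs)
  ... | no _  | no _  | no _  = length-filter-disjoint xs

length-cartesianProduct : ∀ {A B : Set} (xs : List A) (ys : List B) →
  length (cartesianProduct xs ys) ≡ length xs * length ys
length-cartesianProduct []       ys = refl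
length-cartesianProduct (x ∷ xs) ys = trans (length-++ (map (x ,_) ys))
  (cong₂ _+_ (length-map (x ,_) ys) (length-cartesianProduct xs ys))

-- Vertices selected by a Boolean predicate

module _ {A : Set} (C : A → Bool) where

  open Decidable⇒UIP Bool._≟_ using () renaming (≡-irrelevant to Bool-≡-irrelevant)

  Sub : Set
  Sub = Σ A λ x → C x ≡ true

  -- Equality proofs between Booleans are unique, so the certificate of membership carries no
  -- information.
  Sub-≡ : {x y : Sub} → proj₁ x ≡ proj₁ y → x ≡ y
  Sub-≡ {_ , p} {_ , q} refl = cong (_ ,_) (Bool-≡-irrelevant p q)

  restrict : List A → List Sub
  restrict [] = []
  restrict (x ∷ xs) with C x Bool.≟ true
  ... | yes c = (x , c) ∷ restrict xs
  ... | no _  = restrict xs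

  ∈-restrict⁺ : ∀ {x} xs → proj₁ x ∈ xs → x ∈ restrict xs
  ∈-restrict⁺ {x , c} (y ∷ xs) x∈ with C y Bool.≟ true | x∈
  ... | yes _ | here x≡y  = here (Sub-≡ x≡y)
  ... | yes _ | there x∈′ = there (∈-restrict⁺ xs x∈′)
  ... | no ¬c | here refl = contradiction c ¬c
  ... | no _  | there x∈′ = ∈-restrict⁺ xs x∈′

  ∈-restrict⁻ : ∀ {x} xs → x ∈ restrict xs → proj₁ x ∈ xs
  ∈-restrict⁻ (y ∷ xs) x∈ with C y Bool.≟ true | x∈
  ... | yes _ | here refl = here refl
  ... | yes _ | there x∈′ = there (∈-restrict⁻ xs x∈′)
  ... | no _  | x∈′       = there (∈-restrict⁻ xs x∈′)

  restrict-unique : ∀ {xs} → Unique xs → Unique (restrict xs)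
  restrict-unique {[]} _ = []
  restrict-unique {x ∷ xs} (x∉ ∷ u) with C x Bool.≟ true
  ... | yes _ = All.tabulate (λ z∈ x≡z → All.lookup x∉ (∈-restrict⁻ xs z∈) (cong proj₁ x≡z))
                ∷ restrict-unique u
  ... | no _  = restrict-unique u

  length-restrict : ∀ xs → (∀ {x} → x ∈ xs → C x ≡ true) → length (restrict xs) ≡ length xs
  length-restrict [] _ = refl
  length-restrict (x ∷ xs) all with C x Bool.≟ true
  ... | yes _ = cong suc (length-restrict xs (all ∘ there))
  ... | no ¬c = contradiction (all (here refl)) ¬c

-- Walks and neighbourhood cuts

module _ {G H : Graph} (f : V G → V H) (hom : ∀ {u v} → Adj G u v → Adj H (f u) (f v)) where

  Reach-map : ∀ {u v} → Reach G u v → Reach H (f u) (f v)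
  Reach-map here       = here
  Reach-map (step a r) = step (hom a) (Reach-map r)

  ReachIn-map : ∀ {P : V G → Set} {Q : V H → Set} → (∀ {v} → P v → Q (f v)) →
    ∀ {u v} → ReachIn G P u v → ReachIn H Q (f u) (f v)
  ReachIn-map P⇒Q (here p)     = here (P⇒Q p)
  ReachIn-map P⇒Q (step p a r) = step (P⇒Q p) (hom a) (ReachIn-map P⇒Q r)

module _ {G : Graph} where

  Reach-trans : ∀ {u v w} → Reach G u v → Reach G v w → Reach G u w
  Reach-trans here       s = s
  Reach-trans (step a r) s = step a (Reach-trans r s)

  module _ {P : V G → Set} where

    ReachIn-trans : ∀ {u v w} → ReachIn G P u v → ReachIn G P v w → ReachIn G P u w
    ReachIn-trans (here _)     s = s
    ReachIn-trans (step p a r) s = step p a (ReachIn-trans r s)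

    ReachIn-source : ∀ {u v} → ReachIn G P u v → P u
    ReachIn-source (here p)     = p
    ReachIn-source (step p _ _) = p

    ReachIn-sym : ∀ {u v} → ReachIn G P u v → ReachIn G P v u
    ReachIn-sym (here p)     = here p
    ReachIn-sym (step p a r) =
      ReachIn-trans (ReachIn-sym r) (step (ReachIn-source r) (sym-adj G a) (here p))

  -- A nonempty walk from `v` begins with a step into `N`. Such cuts bound from above both `κ` and
  -- the minimum cuts of a component.
  neighbourhood-isVertexCut : ∀ {v w} {N : List (V G)} → Unique N →
    (∀ u → (u ∈ N → Adj G v u) × (Adj G v u → u ∈ N)) → v ≢ w → ¬ Adj G v w → IsVertexCut G N
  neighbourhood-isVertexCut {v} {w} {N} uniq N⇔ v≢w ¬vw =
    uniq , v , w , irrefl G ∘ proj₁ (N⇔ v) , ¬vw ∘ proj₁ (N⇔ w) , stuck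
    where
    stuck : ¬ ReachIn G (_∉ N) v w
    stuck (here _)     = v≢w refl
    stuck (step _ a r) = ReachIn-source r (proj₂ (N⇔ _) a)

-- Degrees in products and components

degree>0 : ∀ {G : Graph} {v w d} → Degree G v d → Adj G v w → 0 < d
degree>0 (L , _ , L⇔ , refl) vw = ∈-length (proj₂ (L⇔ _) vw)

×-degree : ∀ {G H : Graph} {u v d e} → Degree G u d → Degree H v e →
  Degree (G ×ᵍ H) (u , v) (d * e)
×-degree (L , uL , L⇔ , refl) (M , uM , M⇔ , refl) =
  cartesianProduct L M , cartesianProduct⁺ uL uM ,
  (λ (a , b) → (λ ab∈ → Product.map (proj₁ (L⇔ a)) (proj₁ (M⇔ b)) (∈-cartesianProduct⁻ L M ab∈)) ,
               (λ (p , q) → ∈-cartesianProduct⁺ (proj₂ (L⇔ a) p) (proj₂ (M⇔ b) q))) ,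
  length-cartesianProduct L M

-- Closure under adjacency keeps every neighbour of `v` inside `C`, so restricting the list of
-- neighbours loses nothing.
component-degree : ∀ {G : Graph} {C : V G → Bool} →
  (∀ {u v} → Adj G u v → C u ≡ true → C v ≡ true) → ∀ {v d} (c : C v ≡ true) → Degree G v d → Degree (G [ C ]) (v , c) d
component-degree {C = C} closed c (L , uL , L⇔ , refl) =
  restrict C L , restrict-unique C uL ,
  (λ (a , _) → proj₁ (L⇔ a) ∘ ∈-restrict⁻ C L , ∈-restrict⁺ C L ∘ proj₂ (L⇔ a)) ,
  length-restrict C L λ x∈ → closed (proj₁ (L⇔ _) x∈) c

-- Enumerating a finite graph

module FiniteGraph (G : Graph) (fin : Finite G) where

  private
    m = proj₁ fin
  open Inverse (proj₂ fin) using (to; from; strictlyInverseˡ; strictlyInverseʳ)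

  from-injective : ∀ {i j} → from i ≡ from j → i ≡ j
  from-injective eq = trans (sym (strictlyInverseˡ _)) (trans (cong to eq) (strictlyInverseˡ _))

  _≟ⱽ_ : DecidableEquality (V G)
  u ≟ⱽ v with to u Fin.≟ to v
  ... | yes eq = yes (trans (sym (strictlyInverseʳ u)) (trans (cong from eq) (strictlyInverseʳ v)))
  ... | no ¬eq = no (¬eq ∘ cong to)

  vertices : List (V G)
  vertices = map from (allFin m)

  vertices-unique : Unique vertices
  vertices-unique = map⁺ from-injective (allFin⁺ m)

  ∈-vertices : ∀ v → v ∈ vertices
  ∈-vertices v = subst (_∈ vertices) (strictlyInverseʳ v) (∈-map⁺ from (∈-allFin (to v)))

  neighbours : V G → List (V G)
  neighbours v = filter (adj? G v) vertices

  neighbours-degree : ∀ v → Degree G v (length (neighbours v))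
  neighbours-degree v = neighbours v , filter⁺ (adj? G v) {vertices} vertices-unique ,
    (λ u → proj₂ ∘ ∈-filter⁻ (adj? G v) {xs = vertices} , ∈-filter⁺ (adj? G v) (∈-vertices u)) , refl

-- The even cycle

even : ℕ → Bool
even zero    = true
even (suc k) = not (even k)

even-+-*2 : ∀ k c → even (k + c * 2) ≡ even k
even-+-*2 k zero    = cong even (+-identityʳ k)
even-+-*2 k (suc c) = begin
  even (k + suc (suc (c * 2)))     ≡⟨ cong even (trans (+-suc k _) (cong suc (+-suc k _))) ⟩
  not (not (even (k + c * 2)))     ≡⟨ not-involutive _ ⟩
  even (k + c * 2)                 ≡⟨ even-+-*2 k c ⟩
  even k                           ∎
  where open ≡-Reasoning

even-+-2∣ : ∀ k {m} → 2 ∣ m → even (k + m) ≡ even k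
even-+-2∣ k (divides c refl) = even-+-*2 k c

even-∸ : ∀ {m} → 2 ∣ m → ∀ k → k ≤ m → even (m ∸ k) ≡ even k
even-∸ {m} 2∣m zero k≤m = even-+-2∣ 0 2∣m
even-∸ {m} 2∣m (suc k) k<m = not-injective (begin
  not (even (m ∸ suc k)) ≡⟨ cong even (+-∸-assoc 1 k<m) ⟨
  even (m ∸ k)           ≡⟨ even-∸ 2∣m k (<⇒≤ k<m) ⟩
  even k                 ≡⟨ not-involutive _ ⟨
  not (not (even k))     ∎)
  where open ≡-Reasoning

module EvenCycle (n : ℕ) (3≤n : 3 ≤ n) (2∣n : 2 ∣ n) where

  instance
    n≢0 : NonZero n
    n≢0 = >-nonZero (≤-trans (s≤s z≤n) 3≤n)

  Succ-functional : ∀ {i j k} → Succ n i j → Succ n i k → j ≡ k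
  Succ-functional (inj₁ p) (inj₁ q) = toℕ-injective (trans p (sym q))
  Succ-functional {j = j} (inj₁ p) (inj₂ (_ , q , _)) = contradiction (trans p q) (<⇒≢ (toℕ<n j))
  Succ-functional {k = k} (inj₂ (_ , p , _)) (inj₁ q) = contradiction (trans q p) (<⇒≢ (toℕ<n k))
  Succ-functional (inj₂ (_ , _ , p)) (inj₂ (_ , _ , q)) = toℕ-injective (trans p (sym q))

  Succ-injective : ∀ {i j k} → Succ n i k → Succ n j k → i ≡ j
  Succ-injective (inj₁ p) (inj₁ q) = toℕ-injective (suc-injective (trans (sym p) q))
  Succ-injective (inj₁ p) (inj₂ (_ , _ , q)) with () ← trans (sym p) q
  Succ-injective (inj₂ (_ , _ , p)) (inj₁ q) with () ← trans (sym q) p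
  Succ-injective (inj₂ (_ , p , _)) (inj₂ (_ , q , _)) =
    toℕ-injective (suc-injective (trans p (sym q)))

  Succ-even : ∀ {i j} → Succ n i j → even (toℕ j) ≡ not (even (toℕ i))
  Succ-even (inj₁ p) = cong even p
  -- On the wrap-around edge from `n - 1` to `0`, parity alternates because `n` is even.
  Succ-even (inj₂ (_ , p , q)) =
    trans (cong even q) (trans (sym (even-+-2∣ 0 2∣n)) (cong even (sym p)))

  Cycle-bipartite : ∀ i j → Adj (Cycle n) i j → even (toℕ j) ≡ not (even (toℕ i))
  Cycle-bipartite i j (inj₁ s) = Succ-even s
  Cycle-bipartite i j (inj₂ s) = trans (sym (not-involutive _)) (cong not (sym (Succ-even s)))

  -- Layers are indexed by all natural numbers modulo `n`, so that walking past the wrap-around is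
  -- plain addition.
  pos : ℕ → Fin n
  pos k = k mod n

  toℕ-pos : ∀ k → toℕ (pos k) ≡ k % n
  toℕ-pos k = toℕ-fromℕ< (m%n<n k n)

  toℕ-pos-< : ∀ {k} → k < n → toℕ (pos k) ≡ k
  toℕ-pos-< {k} k<n = trans (toℕ-pos k) (m<n⇒m%n≡m k<n)

  pos-toℕ : ∀ i → pos (toℕ i) ≡ i
  pos-toℕ i = toℕ-injective (toℕ-pos-< (toℕ<n i))

  pos-+n : ∀ k → pos (k + n) ≡ pos k
  pos-+n k = toℕ-injective (trans (toℕ-pos (k + n)) (trans ([m+n]%n≡m%n k n) (sym (toℕ-pos k))))

  even-pos : ∀ k → even (toℕ (pos k)) ≡ even k
  even-pos k = begin
    even (toℕ (pos k))           ≡⟨ cong even (toℕ-pos k) ⟩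
    even (k % n)                 ≡⟨ even-+-2∣ (k % n) (∣n⇒∣m*n (k / n) 2∣n) ⟨
    even (k % n + (k / n) * n)   ≡⟨ cong even (m≡m%n+[m/n]*n k n) ⟨
    even k                       ∎
    where open ≡-Reasoning

  Succ-pos : ∀ k → Succ n (pos k) (pos (suc k))
  Succ-pos k = byCases (suc (k % n) <? n)
    where
    open ≡-Reasoning
    toℕ-pos-suc : toℕ (pos (suc k)) ≡ suc (k % n) % n
    toℕ-pos-suc = begin
      toℕ (pos (suc k))                    ≡⟨ toℕ-pos (suc k) ⟩
      suc k % n                            ≡⟨ cong (λ m → suc m % n) (m≡m%n+[m/n]*n k n) ⟩
      (suc (k % n) + (k / n) * n) % n      ≡⟨ [m+kn]%n≡m%n (suc (k % n)) (k / n) n ⟩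
      suc (k % n) % n                      ∎
    byCases : Dec (suc (k % n) < n) → Succ n (pos k) (pos (suc k))
    byCases (yes lt) = inj₁ (trans toℕ-pos-suc (trans (m<n⇒m%n≡m lt) (cong suc (sym (toℕ-pos k)))))
    byCases (no ¬lt) = inj₂ (3≤n , trans (cong suc (toℕ-pos k)) wrap ,
                             trans toℕ-pos-suc (trans (cong (_% n) wrap) (n%n≡0 n)))
      where
      wrap : suc (k % n) ≡ n
      wrap = ≤-antisym (m%n<n k n) (≮⇒≥ ¬lt)

  Adj-pos : ∀ k → Adj (Cycle n) (pos k) (pos (suc k))
  Adj-pos k = inj₁ (Succ-pos k)

  -- Numbers with equal remainders are ordered as their quotients, and distinct quotients put them
  -- at least `n` apart.
  pos-collision : ∀ {k l} → k < l → pos k ≡ pos l → k + n ≤ l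
  pos-collision {k} {l} k<l eq = begin
    k + n                        ≡⟨ cong (_+ n) (m≡m%n+[m/n]*n k n) ⟩
    k % n + (k / n) * n + n      ≡⟨ +-assoc (k % n) _ n ⟩
    k % n + ((k / n) * n + n)    ≡⟨ cong₂ _+_ k%n≡l%n (+-comm _ n) ⟩
    l % n + suc (k / n) * n      ≤⟨ +-monoʳ-≤ (l % n) (*-monoˡ-≤ n quotients) ⟩
    l % n + (l / n) * n          ≡⟨ m≡m%n+[m/n]*n l n ⟨
    l                            ∎
    where
    open ≤-Reasoning
    k%n≡l%n : k % n ≡ l % n
    k%n≡l%n = trans (sym (toℕ-pos k)) (trans (cong toℕ eq) (toℕ-pos l))
    quotients : k / n < l / n
    quotients = ≰⇒> λ le → <⇒≱ k<l (begin
      l                    ≡⟨ m≡m%n+[m/n]*n l n ⟩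
      l % n + (l / n) * n  ≤⟨ +-mono-≤ (≤-reflexive (sym k%n≡l%n)) (*-monoˡ-≤ n le) ⟩
      k % n + (k / n) * n  ≡⟨ m≡m%n+[m/n]*n k n ⟨
      k                    ∎)

  pos-distinct : ∀ {k l} → k < l → l < k + n → pos k ≢ pos l
  pos-distinct k<l l<k+n eq = <⇒≱ l<k+n (pos-collision k<l eq)

  module From (b : Fin n) where

    -- The cycle unrolled from `b`: indices `0` and `n` both stand for `b`, so counting up from `0`
    -- and down from `n` are the two ways round.
    turn : ℕ → Fin n
    turn k = pos (toℕ b + k)

    turn-0 : turn 0 ≡ b
    turn-0 = trans (cong pos (+-identityʳ (toℕ b))) (pos-toℕ b)

    turn-n : turn n ≡ turn 0
    turn-n = trans (pos-+n (toℕ b)) (cong pos (sym (+-identityʳ (toℕ b))))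

    Succ-turn : ∀ k → Succ n (turn k) (turn (suc k))
    Succ-turn k = subst (λ m → Succ n (turn k) (pos m)) (sym (+-suc (toℕ b) k)) (Succ-pos (toℕ b + k))

    turn-distinct : ∀ {k l} → k < l → l < k + n → turn k ≢ turn l
    turn-distinct {k} {l} k<l l<k+n = pos-distinct (+-monoʳ-< (toℕ b) k<l)
      (subst (toℕ b + l <_) (sym (+-assoc (toℕ b) k n)) (+-monoʳ-< (toℕ b) l<k+n))

    turn-surjective : ∀ i → ∃ λ k → k ≤ n × turn k ≡ i
    turn-surjective i with toℕ b ≤? toℕ i
    ... | yes b≤i = toℕ i ∸ toℕ b , ≤-trans (m∸n≤m (toℕ i) (toℕ b)) (<⇒≤ (toℕ<n i)) ,
                    trans (cong pos (m+[n∸m]≡n b≤i)) (pos-toℕ i)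
    -- When `i` precedes `b`, a full lap is added first, so that the truncated subtraction is exact.
    ... | no b≰i = toℕ i + n ∸ toℕ b ,
                   m≤n+o⇒m∸n≤o (toℕ i + n) (toℕ b) (+-monoˡ-≤ n (<⇒≤ (≰⇒> b≰i))) ,
                   trans (cong pos (m+[n∸m]≡n (m≤n⇒m≤o+n (toℕ i) (<⇒≤ (toℕ<n b)))))
                         (trans (pos-+n (toℕ i)) (pos-toℕ i))

    Cycle-neighbour : ∀ k j → Adj (Cycle n) (turn (suc k)) j → j ≡ turn k ⊎ j ≡ turn (suc (suc k))
    Cycle-neighbour k j (inj₁ s) = inj₂ (Succ-functional s (Succ-turn (suc k)))
    Cycle-neighbour k j (inj₂ s) = inj₁ (Succ-injective s (Succ-turn k))

  -- Provides a second copy of a vertex of the product in the same component; the two layers differ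
  -- because `3 ≤ n`.
  distance-two : ∀ i → ∃ λ j → i ≢ j × even (toℕ j) ≡ even (toℕ i)
  distance-two i = turn 2 , (λ eq → turn-distinct {0} {2} (s≤s z≤n) 3≤n (trans turn-0 eq)) , (begin
    even (toℕ (turn 2))               ≡⟨ Succ-even (Succ-turn 1) ⟩
    not (even (toℕ (turn 1)))         ≡⟨ cong not (Succ-even (Succ-turn 0)) ⟩
    not (not (even (toℕ (turn 0))))   ≡⟨ not-involutive _ ⟩
    even (toℕ (turn 0))               ≡⟨ cong (even ∘ toℕ) turn-0 ⟩
    even (toℕ i)                      ∎)
    where
    open From i
    open ≡-Reasoning

  predecessor : ∀ i → ∃ λ b → From.turn b 1 ≡ i
  -- Going forward by `n - 1` replaces going back by one, which could underflow at `0`.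
  predecessor i = pos m , Succ-functional
    (subst (λ j → Succ n j (turn 1)) turn-0 (Succ-turn 0))
    (subst (Succ n (pos m)) (begin
      pos (suc m)                ≡⟨ cong pos (+-suc (toℕ i) (pred n)) ⟨
      pos (toℕ i + suc (pred n)) ≡⟨ cong (λ l → pos (toℕ i + l)) (suc-pred n) ⟩
      pos (toℕ i + n)            ≡⟨ pos-+n (toℕ i) ⟩
      pos (toℕ i)                ≡⟨ pos-toℕ i ⟩
      i                          ∎) (Succ-pos m))
    where
    open ≡-Reasoning
    m = toℕ i + pred n
    open From (pos m)

  Cycle-degree : ∀ i → Degree (Cycle n) i 2
  Cycle-degree i with predecessor i
  ... | b , refl =
    turn 0 ∷ turn 2 ∷ [] ,
    (turn-distinct {0} {2} (s≤s z≤n) 3≤n ∷ []) ∷ [] ∷ [] ,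
    (λ j → (λ { (here refl) → inj₂ (Succ-turn 0) ; (there (here refl)) → inj₁ (Succ-turn 1) }) ,
           [ here , there ∘ here ]′ ∘ Cycle-neighbour 0 j) ,
    refl
    where open From b

  -- `opposite` sends `i` to `n - 1 - i` and so reverses arcs; the arc from `n - 1` to `0` goes to
  -- itself.
  opposite-Succ : ∀ {i j} → Succ n i j → Succ n (opposite j) (opposite i)
  opposite-Succ {i} {j} (inj₁ p) = inj₁ (begin
    toℕ (opposite i)             ≡⟨ opposite-prop i ⟩
    n ∸ suc (toℕ i)              ≡⟨ cong (n ∸_) p ⟨
    n ∸ toℕ j                    ≡⟨ +-∸-assoc 1 (toℕ<n j) ⟩
    suc (n ∸ suc (toℕ j))        ≡⟨ cong suc (opposite-prop j) ⟨
    suc (toℕ (opposite j))       ∎)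
    where open ≡-Reasoning
  opposite-Succ {i} {j} (inj₂ (_ , p , q)) = inj₂ (3≤n ,
    trans (cong suc (opposite-prop j)) (trans (sym (+-∸-assoc 1 (toℕ<n j))) (cong (n ∸_) q)) ,
    trans (opposite-prop i) (trans (cong (n ∸_) p) (n∸n≡0 n)))

  opposite-Adj : ∀ {i j} → Adj (Cycle n) i j → Adj (Cycle n) (opposite i) (opposite j)
  opposite-Adj (inj₁ s) = inj₂ (opposite-Succ s)
  opposite-Adj (inj₂ s) = inj₁ (opposite-Succ s)

  -- The two indices add up to `n - 1`, which is odd.
  even-opposite : ∀ i → even (toℕ (opposite i)) ≡ not (even (toℕ i))
  even-opposite i = trans (cong even (opposite-prop i)) (even-∸ 2∣n (suc (toℕ i)) (toℕ<n i))

-- Sums and propagation along indices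

sumBelow : ℕ → (ℕ → ℕ) → ℕ
sumBelow zero    f = 0
sumBelow (suc m) f = sumBelow m f + f m

sumBelow-≥ : ∀ {c} f m → (∀ k → k < m → c ≤ f k) → m * c ≤ sumBelow m f
sumBelow-≥ f zero    _   = z≤n
sumBelow-≥ {c} f (suc m) c≤f = ≤-trans (≤-reflexive (+-comm c (m * c)))
  (+-mono-≤ (sumBelow-≥ f m (λ k k<m → c≤f k (m≤n⇒m≤1+n k<m))) (c≤f m ≤-refl))

-- Telescoping, with f 0 moved to the left so that no subtraction occurs.
sumBelow-consecutive : ∀ f m →
  sumBelow m (λ k → f k + f (suc k)) + f 0 ≡ sumBelow m f * 2 + f m
sumBelow-consecutive f zero    = refl
sumBelow-consecutive f (suc m) = begin
  A + (f m + f (suc m)) + f 0       ≡⟨ reorder A (f m) (f (suc m)) (f 0) ⟩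
  (A + f 0) + (f m + f (suc m))     ≡⟨ cong (_+ (f m + f (suc m))) (sumBelow-consecutive f m) ⟩
  (B * 2 + f m) + (f m + f (suc m)) ≡⟨ regroup B (f m) (f (suc m)) ⟩
  (B + f m) * 2 + f (suc m)         ∎
  where
  open ≡-Reasoning
  A = sumBelow m (λ k → f k + f (suc k))
  B = sumBelow m f
  reorder : ∀ a x y z → a + (x + y) + z ≡ (a + z) + (x + y)
  reorder = solve-∀
  regroup : ∀ b x y → (b * 2 + x) + (x + y) ≡ (b + x) * 2 + y
  regroup = solve-∀

-- Propagation from `0` runs until the first heavy index. That index is itself still good: heaviness
-- blocks only the step beyond it.
scan : ∀ {Good Heavy : ℕ → Set} → Decidable Heavy → ∀ m → Good 0 →
  (∀ k → k < m → Good k → ¬ Heavy k → Good (suc k)) →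
  (∀ k → k ≤ m → Good k) ⊎ ∃ λ p → p < m × Heavy p × (∀ k → k ≤ p → Good k)
scan heavy? zero good₀ next = inj₁ λ { _ z≤n → good₀ }
scan heavy? (suc m) good₀ next with scan heavy? m good₀ (λ k k<m → next k (m≤n⇒m≤1+n k<m))
... | inj₂ (p , p<m , rest) = inj₂ (p , m≤n⇒m≤1+n p<m , rest)
... | inj₁ good with heavy? m
...   | yes h = inj₂ (m , ≤-refl , h , good)
...   | no ¬h = inj₁ λ k k≤ → [ (λ k<sm → good k (s≤s⁻¹ k<sm))
                              , (λ { refl → next m ≤-refl (good m ≤-refl) ¬h }) ]′ (m≤n⇒m<n∨m≡n k≤)

-- Traces of a vertex list on the layers

module _ {A : Set} {n : ℕ} where

  onLayer? : (i : Fin n) → Decidable (λ (x : A × Fin n) → proj₂ x ≡ i)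
  onLayer? i x = proj₂ x Fin.≟ i

  trace : List (A × Fin n) → Fin n → List A
  trace xs i = map proj₁ (filter (onLayer? i) xs)

  length-trace : ∀ xs i → length (trace xs i) ≡ length (filter (onLayer? i) xs)
  length-trace xs i = length-map proj₁ (filter (onLayer? i) xs)

  ∈-trace⁺ : ∀ {a i xs} → (a , i) ∈ xs → a ∈ trace xs i
  ∈-trace⁺ {i = i} ai∈ = ∈-map⁺ proj₁ (∈-filter⁺ (onLayer? i) ai∈ refl)

  ∈-trace⁻ : ∀ {a i} xs → a ∈ trace xs i → (a , i) ∈ xs
  ∈-trace⁻ {i = i} xs a∈ with ∈-map⁻ proj₁ a∈
  ... | _ , x∈ , refl with ∈-filter⁻ (onLayer? i) {xs = xs} x∈
  ...   | x∈xs , refl = x∈xs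

  -- Distinct layers occupy disjoint parts of `xs`. Three layers are compared because two heavy ones
  -- exhaust a minimum cut and leave nothing for a third.
  length-traces : ∀ {i j k} xs → i ≢ j → i ≢ k → j ≢ k →
    length (trace xs i) + length (trace xs j) + length (trace xs k) ≤ length xs
  length-traces {i} {j} {k} xs i≢j i≢k j≢k = begin
    length (trace xs i) + length (trace xs j) + length (trace xs k)
      ≡⟨ cong₂ _+_ (cong₂ _+_ (length-trace xs i) (length-trace xs j)) (length-trace xs k) ⟩
    length (filter (onLayer? i) xs) + length (filter (onLayer? j) xs) + length (filter (onLayer? k) xs)
      ≤⟨ +-monoˡ-≤ _ (length-filter-disjoint (onLayer? i) (onLayer? j) ij? inj₁ inj₂
           (λ p q → i≢j (trans (sym p) q)) xs) ⟩
    length (filter ij? xs) + length (filter (onLayer? k) xs)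
      ≤⟨ length-filter-disjoint ij? (onLayer? k) (λ x → ij? x ⊎-dec onLayer? k x) inj₁ inj₂
           (λ { (inj₁ p) q → i≢k (trans (sym p) q) ; (inj₂ p) q → j≢k (trans (sym p) q) }) xs ⟩
    length (filter (λ x → ij? x ⊎-dec onLayer? k x) xs)
      ≤⟨ length-filter (λ x → ij? x ⊎-dec onLayer? k x) xs ⟩
    length xs ∎
    where
    open ≤-Reasoning
    ij? : Decidable (λ (x : A × Fin n) → proj₂ x ≡ i ⊎ proj₂ x ≡ j)
    ij? x = onLayer? i x ⊎-dec onLayer? j x

-- The layers of G × Cₙ and its components

module Layers (G : Graph) (n : ℕ) (3≤n : 3 ≤ n) (2∣n : 2 ∣ n)
              (Z : V G → Bool) (bip : IsBipartition G Z) where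

  open EvenCycle n 3≤n 2∣n

  -- An edge of the product flips both the side of the vertex and the parity of the layer, so their
  -- agreement is invariant along walks.
  inComponent : V G × Fin n → Bool
  inComponent (v , i) = ⌊ Z v Bool.≟ even (toℕ i) ⌋

  inComponent⁺ : ∀ v i → Z v ≡ even (toℕ i) → inComponent (v , i) ≡ true
  inComponent⁺ v i eq = trans (isYes≗does (Z v Bool.≟ even (toℕ i))) (dec-true (Z v Bool.≟ even (toℕ i)) eq)

  inComponent⁻ : ∀ v i → inComponent (v , i) ≡ true → Z v ≡ even (toℕ i)
  inComponent⁻ v i c with Z v Bool.≟ even (toℕ i)
  ... | yes eq = eq

  flip-side : ∀ {u v} → Adj G u v → Z v ≡ not (Z u)
  flip-side uv = ¬-not (bip _ _ (sym-adj G uv))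

  component-closed : ∀ {p q} → Adj (G ×ᵍ Cycle n) p q → inComponent p ≡ true → inComponent q ≡ true
  component-closed {u , i} {v , j} (uv , ij) c = inComponent⁺ v j
    (trans (flip-side uv) (trans (cong not (inComponent⁻ u i c)) (sym (Cycle-bipartite i j ij))))

  component-Reach : ∀ {p q} → Reach (G ×ᵍ Cycle n) p q → inComponent p ≡ true → inComponent q ≡ true
  component-Reach here       c = c
  component-Reach {p} (step {w = w} a r) c = component-Reach r (component-closed {p} {w} a c)

  -- The copy of G spanned by the adjacent layers i and j: each vertex goes to the layer of its side.
  module Fold {i j : Fin n} (ij : Adj (Cycle n) i j) where

    layer : V G → Fin n
    layer v = if inComponent (v , i) then i else j

    layer-either : ∀ v → layer v ≡ i ⊎ layer v ≡ j
    layer-either v with inComponent (v , i)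
    ... | true  = inj₁ refl
    ... | false = inj₂ refl

    layer-inComponent : ∀ v → inComponent (v , layer v) ≡ true
    layer-inComponent v with inComponent (v , i) in eq
    ... | true  = eq
    ... | false = inComponent⁺ v j (trans
      (¬-not λ p → contradiction (trans (sym (inComponent⁺ v i p)) eq) λ ())
      (sym (Cycle-bipartite i j ij)))

    -- Adjacent layers have opposite parities, so `v` fits the component in only one of them.
    layer-determined : ∀ {v k} → inComponent (v , k) ≡ true → k ≡ i ⊎ k ≡ j → layer v ≡ k
    layer-determined {v} c (inj₁ refl) rewrite c = refl
    layer-determined {v} c (inj₂ refl) with layer-either v | layer-inComponent v
    ... | inj₂ eq | _  = eq
    ... | inj₁ eq | c′ = contradiction
      (trans (inComponent⁻ v j c) (trans (Cycle-bipartite i j ij)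
        (cong not (sym (inComponent⁻ v i (subst (λ k → inComponent (v , k) ≡ true) eq c′))))))
      (not-¬ refl)

    same-layer : ∀ {u v} → layer u ≡ layer v → Z u ≡ Z v
    same-layer {u} {v} eq = trans (inComponent⁻ u (layer u) (layer-inComponent u))
      (trans (cong (even ∘ toℕ) eq) (sym (inComponent⁻ v (layer v) (layer-inComponent v))))

    -- The ends of an edge of `G` are on different sides, hence never folded into one layer. Thus
    -- `fold` is a homomorphism.
    layer-Adj : ∀ {u v} → Adj G u v → Adj (Cycle n) (layer u) (layer v)
    layer-Adj {u} {v} uv with layer-either u | layer-either v
    ... | inj₁ p | inj₂ q = subst₂ (Adj (Cycle n)) (sym p) (sym q) ij
    ... | inj₂ p | inj₁ q = subst₂ (Adj (Cycle n)) (sym p) (sym q) (sym-adj (Cycle n) ij)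
    ... | inj₁ p | inj₁ q = contradiction (same-layer (trans p (sym q))) (bip u v uv)
    ... | inj₂ p | inj₂ q = contradiction (same-layer (trans p (sym q))) (bip u v uv)

    fold : V G → V (G ×ᵍ Cycle n)
    fold v = v , layer v

  module _ (conn : Connected G) (neighbour : ∀ v → ∃ (Adj G v)) {z : V G} (z∈Z : Z z ≡ true) where

    origin : V (G ×ᵍ Cycle n)
    origin = z , pos 0

    -- Layer `0` is reached by folding walks of `G` into layers `0` and `1`; a vertex of layer
    -- `k + 1` is then entered from a neighbour in layer `k`.
    Reach-origin : ∀ k w → Z w ≡ even k → Reach (G ×ᵍ Cycle n) origin (w , pos k)
    Reach-origin zero w eq = subst₂ (Reach (G ×ᵍ Cycle n)) (at-0 z∈Z) (at-0 eq)
      (Reach-map {H = G ×ᵍ Cycle n} fold (λ uv → uv , layer-Adj uv) (conn z w))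
      where
      open Fold (Adj-pos 0)
      at-0 : ∀ {v} → Z v ≡ true → fold v ≡ (v , pos 0)
      at-0 {v} v∈Z = cong (v ,_)
        (layer-determined (inComponent⁺ v (pos 0) (trans v∈Z (sym (even-pos 0)))) (inj₁ refl))
    Reach-origin (suc k) w eq with neighbour w
    ... | v , wv = Reach-trans
      (Reach-origin k v (trans (flip-side wv) (trans (cong not eq) (not-involutive _))))
      (step (sym-adj G wv , Adj-pos k) here)

    inComponent-isComponent : IsComponentOf (G ×ᵍ Cycle n) origin inComponent
    inComponent-isComponent (w , i) =
      (λ c → subst (λ j → Reach (G ×ᵍ Cycle n) origin (w , j)) (pos-toℕ i)
               (Reach-origin (toℕ i) w (inComponent⁻ w i c))) ,
      λ r → component-Reach r (inComponent⁺ z (pos 0) (trans z∈Z (sym (even-pos 0))))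

-- Total size of the traces

module _ (n : ℕ) (3≤n : 3 ≤ n) (2∣n : 2 ∣ n) {A : Set} (xs : List (A × Fin n)) where

  open EvenCycle n 3≤n 2∣n

  private
    below? : ∀ m → Decidable (λ (x : A × Fin n) → toℕ (proj₂ x) < m)
    below? m x = toℕ (proj₂ x) <? m

    -- The part in layers below `m` and the part in layer `m` are disjoint; `m ≤ n` prevents the
    -- indices from wrapping round to a layer already counted.
    sum-traces-below : ∀ m → m ≤ n →
      sumBelow m (λ k → length (trace xs (pos k))) ≤ length (filter (below? m) xs)
    sum-traces-below zero    _   = z≤n
    sum-traces-below (suc m) m<n = begin
      sumBelow m (λ k → length (trace xs (pos k))) + length (trace xs (pos m))
        ≤⟨ +-mono-≤ (sum-traces-below m (<⇒≤ m<n)) (≤-reflexive (length-trace xs (pos m))) ⟩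
      length (filter (below? m) xs) + length (filter (onLayer? (pos m)) xs)
        ≤⟨ length-filter-disjoint (below? m) (onLayer? (pos m)) (below? (suc m)) m≤n⇒m≤1+n
             (λ {x} eq → s≤s (≤-reflexive (at x eq)))
             (λ {x} lt eq → <⇒≢ lt (at x eq)) xs ⟩
      length (filter (below? (suc m)) xs) ∎
      where
      open ≤-Reasoning
      at : ∀ (x : A × Fin n) → proj₂ x ≡ pos m → toℕ (proj₂ x) ≡ m
      at x eq = trans (cong toℕ eq) (toℕ-pos-< m<n)

  sum-traces : sumBelow n (λ k → length (trace xs (pos k))) ≤ length xs
  sum-traces = ≤-trans (sum-traces-below n ≤-refl) (length-filter (below? n) xs)

-- Minimum cuts of a component

module SuperConnected
  (G : Graph) (fin : Finite G) (neighbour : ∀ v → ∃ (Adj G v))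
  (n : ℕ) (3≤n : 3 ≤ n) (2∣n : 2 ∣ n)
  (Z : V G → Bool) (bip : IsBipartition G Z)
  (δ κ : ℕ) (side : ∀ c → ∃ λ L → Unique L × (∀ {v} → v ∈ L → Z v ≡ c) × δ < length L)
  (minDeg : MinDegree G δ) (connectivity : Connectivity G κ) (4δ<nκ : 4 * δ < n * κ) where

  open FiniteGraph G fin
  open EvenCycle n 3≤n 2∣n
  open Layers G n 3≤n 2∣n Z bip

  δ≤degree : ∀ v → δ ≤ length (neighbours v)
  δ≤degree v = proj₂ minDeg v _ (neighbours-degree v)

  v₀ : V G
  v₀ = proj₁ (proj₁ minDeg)

  v₀-degree : Degree G v₀ δ
  v₀-degree = proj₂ (proj₁ minDeg)

  δ>0 : 0 < δ
  δ>0 = degree>0 {G} v₀-degree (proj₂ (neighbour v₀))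

  κ>0 : 0 < κ
  κ>0 = n≢0⇒n>0 λ κ≡0 → n≮0 (subst (4 * δ <_) (trans (cong (n *_) κ≡0) (*-zeroʳ n)) 4δ<nκ)

  -- The side of `v` has more than `δ ≥ 1` vertices, and two vertices of one side are never
  -- adjacent.
  nonadjacent : ∀ v → ∃ λ w → v ≢ w × ¬ Adj G v w
  nonadjacent v with L , uL , L⊆ , δ<L ← side (Z v)
    with w , w∈L , w∉ ← unique-longer⇒∃∉ _≟ⱽ_ {L} {v ∷ []} uL (≤-<-trans δ>0 δ<L) =
    w , (λ v≡w → w∉ (here (sym v≡w))) , λ vw → bip v w vw (sym (L⊆ w∈L))

  κ-≤-cut : ∀ T → IsVertexCut G T → κ ≤ length T
  κ-≤-cut = proj₂ (proj₂ connectivity λ complete →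
    let w , v≢w , ¬vw = nonadjacent v₀ in ¬vw (complete v₀ w v≢w))

  -- The neighbourhood of a vertex of minimum degree is a cut of `G`.
  κ≤δ : κ ≤ δ
  κ≤δ = let L , uL , L⇔ , |L|≡δ = v₀-degree
            w , v≢w , ¬vw = nonadjacent v₀
        in subst (κ ≤_) |L|≡δ (κ-≤-cut L (neighbourhood-isVertexCut uL L⇔ v≢w ¬vw))

  H : Graph
  H = (G ×ᵍ Cycle n) [ inComponent ]

  _≟ᴴ_ : DecidableEquality (V H)
  x ≟ᴴ y with ≡-dec _≟ⱽ_ Fin._≟_ (proj₁ x) (proj₁ y)
  ... | yes eq = yes (Sub-≡ inComponent eq)
  ... | no ¬eq = no (¬eq ∘ cong proj₁)

  open import Data.List.Membership.DecPropositional _≟ᴴ_ using (_∈?_)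

  H-degree : ∀ {v d} i c → Degree G v d → Degree H ((v , i) , c) (d * 2)
  H-degree i c deg = component-degree {G ×ᵍ Cycle n} {inComponent}
    (λ {p} {q} → component-closed {p} {q}) c (×-degree {G} {Cycle n} deg (Cycle-degree i))

  -- The vertex separated from `(v , i)` is the copy of `v` two layers further on: parity keeps it
  -- in the component, and looplessness of `G` makes it nonadjacent.
  neighbourhood-isCut : ∀ x {e} (deg : Degree H x e) → IsVertexCut H (proj₁ deg)
  neighbourhood-isCut ((v , i) , c) (L , uL , L⇔ , _) with j , i≢j , same ← distance-two i =
    neighbourhood-isVertexCut {H} {(v , i) , c} {(v , j) , inComponent⁺ v j (trans (inComponent⁻ v i c) (sym same))}
      uL L⇔ (i≢j ∘ cong (proj₂ ∘ proj₁)) (irrefl G {v} ∘ proj₁)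

  H-neighbours : ∀ x → Degree H x (length (neighbours (proj₁ (proj₁ x))) * 2)
  H-neighbours ((v , i) , c) = H-degree i c (neighbours-degree v)

  H-vertices : List (V H)
  H-vertices = restrict inComponent (cartesianProduct vertices (allFin n))

  ∈-H-vertices : ∀ x → x ∈ H-vertices
  ∈-H-vertices ((v , i) , c) = ∈-restrict⁺ inComponent (cartesianProduct vertices (allFin n))
    (∈-cartesianProduct⁺ (∈-vertices v) (∈-allFin i))

  module _ {S : List (V H)} (minCut : IsMinVertexCut H S) where

    |S|≤degree : ∀ x {e} → Degree H x e → length S ≤ e
    |S|≤degree x deg@(L , _ , _ , refl) = proj₂ minCut L (neighbourhood-isCut x deg)

    minDegreeVertex : ∃ λ x → Degree H x (δ * 2)
    minDegreeVertex =
      -- `v₀` may be on either side, so it is put into whichever of the layers `0` and `1` fits.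
      (fold v₀ , layer-inComponent v₀) , H-degree (layer v₀) (layer-inComponent v₀) v₀-degree
      where open Fold (Adj-pos 0)

    |S|≤2δ : length S ≤ δ * 2
    |S|≤2δ = |S|≤degree (proj₁ minDegreeVertex) (proj₂ minDegreeVertex)

    S′ : List (V G × Fin n)
    S′ = map proj₁ S

    tr : Fin n → List (V G)
    tr = trace S′

    s : Fin n → ℕ
    s i = length (tr i)

    ∈S⇒∈tr : ∀ {v i c} → ((v , i) , c) ∈ S → v ∈ tr i
    ∈S⇒∈tr x∈ = ∈-trace⁺ (∈-map⁺ proj₁ x∈)

    ∈tr⇒∈S : ∀ {v i} c → v ∈ tr i → ((v , i) , c) ∈ S
    ∈tr⇒∈S c v∈ with ∈-map⁻ proj₁ (∈-trace⁻ S′ v∈)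
    ... | x , x∈S , eq = subst (_∈ S) (Sub-≡ inComponent (sym eq)) x∈S

    ∈tr⇒inComponent : ∀ {v i} → v ∈ tr i → inComponent (v , i) ≡ true
    ∈tr⇒inComponent v∈ with ∈-map⁻ proj₁ (∈-trace⁻ S′ v∈)
    ... | (_ , c) , _ , refl = c

    |S′|≤2δ : length S′ ≤ δ * 2
    |S′|≤2δ = ≤-trans (≤-reflexive (length-map proj₁ S)) |S|≤2δ

    -- Averaging: each layer occurs in two of the `n` consecutive pairs, so the pair sums total at
    -- most `2|S| ≤ 4δ < nκ`.
    sparsePair : ∃ λ b → s (pos b) + s (pos (suc b)) < κ
    sparsePair with anyUpTo? (λ k → s (pos k) + s (pos (suc k)) <? κ) n
    ... | yes (b , _ , lt) = b , lt
    ... | no none = contradiction 4δ<nκ (≤⇒≯ (begin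
      n * κ              ≤⟨ sumBelow-≥ pairs n (λ k k<n → ≮⇒≥ λ lt → none (k , k<n , lt)) ⟩
      -- The boundary terms `f 0` and `f n` of the telescoped sum cancel because the cycle closes
      -- up.
      sumBelow n pairs   ≡⟨ +-cancelʳ-≡ (f 0) _ _ (trans (sumBelow-consecutive f n)
                              (cong (λ i → sumBelow n f * 2 + s i) (pos-+n 0))) ⟩
      sumBelow n f * 2   ≤⟨ *-monoˡ-≤ 2 (sum-traces n 3≤n 2∣n S′) ⟩
      length S′ * 2      ≤⟨ *-monoˡ-≤ 2 |S′|≤2δ ⟩
      δ * 2 * 2          ≡⟨ trans (*-assoc δ 2 2) (*-comm δ 4) ⟩
      4 * δ              ∎))
      where
      open ≤-Reasoning
      f pairs : ℕ → ℕ
      f k = s (pos k)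
      pairs k = f k + f (suc k)

    -- From `|S| ≤ 2δ ≤ deg x` and `N ⊆ S` follows `N = S`. The degree of `x` is minimum because
    -- `|S|` is at most every degree.
    isolated-suffices : ∀ x → proj₁ (H-neighbours x) ⊆ S →
      Σ (V H) λ v → (Σ ℕ λ d → Degree H v d × MinDegree H d) ×
                    (∀ u → (u ∈ S → Adj H v u) × (Adj H v u → u ∈ S))
    isolated-suffices x N⊆S with H-neighbours x
    ... | deg@(N , uN , N⇔ , lenN) =
      x , (_ , deg , (x , deg) , λ v e degv → ≤-trans |N|≤|S| (|S|≤degree v degv)) ,
      λ u → proj₁ (N⇔ u) ∘ unique-⊆-long⇒⊇ _≟ᴴ_ uN N⊆S |S|≤|N| , N⊆S ∘ proj₂ (N⇔ u)
      where
      degree = length (neighbours (proj₁ (proj₁ x))) * 2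
      |N|≤|S| : degree ≤ length S
      |N|≤|S| = ≤-trans (≤-reflexive (sym lenN)) (unique-⊆⇒length≤ _≟ᴴ_ uN N⊆S)
      |S|≤|N| : length S ≤ length N
      |S|≤|N| = begin
        length S   ≤⟨ |S|≤2δ ⟩
        δ * 2      ≤⟨ *-monoˡ-≤ 2 (δ≤degree (proj₁ (proj₁ x))) ⟩
        degree     ≡⟨ lenN ⟨
        length N   ∎
        where open ≤-Reasoning

    -- Exhaustive search over the finite component makes the case distinction of the main argument
    -- constructive.
    neighboursInS? : Dec (Any (λ x → All (_∈ S) (proj₁ (H-neighbours x))) H-vertices)
    neighboursInS? = any? (λ x → all? (_∈? S) (proj₁ (H-neighbours x))) H-vertices

    -- Cuts that leave every vertex a neighbour outside the cut

    module NoIsolated (escape : ∀ x → ∃ λ y → Adj H x y × y ∉ S) where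

      b : ℕ
      b = proj₁ sparsePair

      open From (pos b)

      sparse : s (turn 0) + s (turn 1) < κ
      sparse = subst₂ (λ i j → s i + s j < κ) (sym turn-0) (sym turn-1) (proj₂ sparsePair)
        where
        turn-1 : turn 1 ≡ pos (suc b)
        turn-1 = Succ-functional (subst (λ i → Succ n i (turn 1)) turn-0 (Succ-turn 0)) (Succ-pos b)

      -- The base layer therefore has a surviving vertex, which becomes `root`, and does not block a
      -- walk round the cycle.
      light-0 : s (turn 0) < δ
      light-0 = ≤-trans (≤-<-trans (m≤m+n _ _) sparse) κ≤δ

      -- Layer `i` is a copy of one side of `G`, which has more than `δ` vertices.
      survivor : ∀ i → s i ≤ δ → ∃ λ v → inComponent (v , i) ≡ true × v ∉ tr i
      survivor i si≤δ =
        let L , uL , L⊆ , δ<L = side (even (toℕ i))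
            v , v∈L , v∉ = unique-longer⇒∃∉ _≟ⱽ_ uL (≤-<-trans si≤δ δ<L)
        in v , inComponent⁺ v i (L⊆ v∈L) , v∉

      root : V H
      root = let v , c , _ = survivor (turn 0) (<⇒≤ light-0) in (v , turn 0) , c

      root∉S : root ∉ S
      root∉S = proj₂ (proj₂ (survivor (turn 0) (<⇒≤ light-0))) ∘ ∈S⇒∈tr

      -- G − T is connected only up to double negation: being a cut is a negative statement.
      Conn : V H → Set
      Conn x = ¬ ¬ ReachIn H (_∉ S) root x

      Conn-step : ∀ {x y} → Conn x → x ∉ S → Adj H x y → y ∉ S → Conn y
      Conn-step connx x∉S xy y∉S ¬r = connx λ r → ¬r (ReachIn-trans r (step x∉S xy (here y∉S)))

      Good : Fin n → Set
      Good i = ∀ v (c : inComponent (v , i) ≡ true) → v ∉ tr i → Conn ((v , i) , c)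

      -- A vertex of layer `j` has at least `δ` neighbours in layer `i`, and `S` cannot contain them
      -- all.
      Good-next : ∀ {i j} → Adj (Cycle n) i j → Good i → s i < δ → Good j
      Good-next {i} {j} ij good si<δ v c v∉ =
        let _ , uN , N⇔ , _ = neighbours-degree v
            u , u∈N , u∉ = unique-longer⇒∃∉ _≟ⱽ_ uN (<-≤-trans si<δ (δ≤degree v))
            vu = proj₁ (N⇔ u) u∈N
            cu = component-closed {v , j} {u , i} (vu , sym-adj (Cycle n) ij) c
        in Conn-step (good u cu u∉) (u∉ ∘ ∈S⇒∈tr) (sym-adj G vu , ij) (v∉ ∘ ∈S⇒∈tr)

      -- The neighbour supplied by `escape` lies in an adjacent layer, hence in a good one.
      Good-between : ∀ {i} → (∀ j → Adj (Cycle n) i j → Good j) → Good i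
      Good-between {i} good v c v∉ =
        let ((u , j) , cu) , vu , u∉S = escape ((v , i) , c)
        in Conn-step (good j (proj₂ vu) u cu (u∉S ∘ ∈tr⇒∈S cu)) u∉S
          (sym-adj H {(v , i) , c} {(u , j) , cu} vu) (v∉ ∘ ∈S⇒∈tr)

      -- Two consecutive layers carry a copy of G, from which S removes fewer than κ vertices.
      Good-pair : ∀ {i j} → Adj (Cycle n) i j → s i + s j < κ →
        ∀ {v₁ k₁} c₁ → k₁ ≡ i ⊎ k₁ ≡ j → ((v₁ , k₁) , c₁) ∉ S → Conn ((v₁ , k₁) , c₁) →
        ∀ k → k ≡ i ⊎ k ≡ j → Good k
      Good-pair {i} {j} ij small {v₁} {k₁} c₁ k₁∈ v₁∉S conn₁ k k∈ v c v∉ =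
        -- The refutation `¬r` of the goal allows the double negations to be opened: `r₁` leads from
        -- `root` to the known vertex, and `r`, a walk of `G` avoiding `T`, is folded into the two
        -- layers.
        subst Conn (foldH-≡ c k∈) λ ¬r →
          subst Conn (sym (foldH-≡ c₁ k₁∈)) conn₁ λ r₁ →
          reachG (foldH∉S⇒∉T (subst (_∉ S) (sym (foldH-≡ c₁ k₁∈)) v₁∉S))
                 (foldH∉S⇒∉T (subst (_∉ S) (sym (foldH-≡ c k∈)) (v∉ ∘ ∈S⇒∈tr))) λ r →
          ¬r (ReachIn-trans r₁ (ReachIn-map foldH (λ uv → uv , layer-Adj uv) ∉T⇒foldH∉S r))
        where
        open Fold ij
        T : List (V G)
        -- Vertex cuts are duplicate-free by definition, and deduplication does not lengthen the
        -- list.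
        T = deduplicate _≟ⱽ_ (tr i ++ tr j)

        uniqueT : Unique T
        uniqueT = deduplicate-! _≟ⱽ_ (tr i ++ tr j)

        foldH : V G → V H
        foldH v = fold v , layer-inComponent v

        foldH-≡ : ∀ {v k} c → k ≡ i ⊎ k ≡ j → foldH v ≡ ((v , k) , c)
        foldH-≡ {v} c k∈ = Sub-≡ inComponent (cong (v ,_) (layer-determined c k∈))

        ∉T⇒foldH∉S : ∀ {v} → v ∉ T → foldH v ∉ S
        ∉T⇒foldH∉S {v} v∉T x∈S = v∉T (∈-deduplicate⁺ _≟ⱽ_
          ([ (λ eq → ∈-++⁺ˡ (subst (λ k → v ∈ tr k) eq (∈S⇒∈tr x∈S)))
           , (λ eq → ∈-++⁺ʳ (tr i) (subst (λ k → v ∈ tr k) eq (∈S⇒∈tr x∈S))) ]′ (layer-either v)))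

        -- A vertex in the trace on layer `i` or `j` is in the component there, so folding returns
        -- it to that layer.
        foldH∉S⇒∉T : ∀ {v} → foldH v ∉ S → v ∉ T
        foldH∉S⇒∉T {v} x∉S v∈T = [ at i (inj₁ refl) , at j (inj₂ refl) ]′
          (∈-++⁻ (tr i) (∈-deduplicate⁻ _≟ⱽ_ (tr i ++ tr j) v∈T))
          where
          at : ∀ k → k ≡ i ⊎ k ≡ j → v ∈ tr k → ⊥
          at k k∈ v∈ = x∉S (∈tr⇒∈S (layer-inComponent v)
            (subst (λ l → v ∈ tr l) (sym (layer-determined (∈tr⇒inComponent v∈) k∈)) v∈))

        |T|<κ : length T < κ
        |T|<κ = ≤-<-trans (unique-⊆⇒length≤ _≟ⱽ_ uniqueT (∈-deduplicate⁻ _≟ⱽ_ (tr i ++ tr j)))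
          (subst (_< κ) (sym (length-++ (tr i))) small)

        -- Otherwise `T` would be a vertex cut of `G` with fewer than `κ` vertices.
        reachG : ∀ {u w} → u ∉ T → w ∉ T → ¬ ¬ ReachIn G (_∉ T) u w
        reachG u∉T w∉T ¬r = <⇒≱ |T|<κ (κ-≤-cut T (uniqueT , _ , _ , u∉T , w∉T , ¬r))

      -- The sparse pair is connected through `root`, which reaches itself; both scans start here.
      Good-0 : Good (turn 0)
      Good-0 = Good-pair (inj₁ (Succ-turn 0)) sparse (proj₂ root) (inj₁ refl) root∉S
        (λ ¬r → ¬r (here root∉S)) (turn 0) (inj₁ refl)

      Heavy : ℕ → Set
      Heavy k = δ ≤ s (turn k)

      Good-suc : ∀ k → Good (turn k) → ¬ Heavy k → Good (turn (suc k))
      Good-suc k good ¬heavy = Good-next (inj₁ (Succ-turn k)) good (≰⇒> ¬heavy)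

      -- The gap between two heavy layers

      module Gap {p q : ℕ} (p<q : p < q) (q<n : q < n) (heavyp : Heavy p) (heavyq : Heavy q)
                 (goodp : Good (turn p)) (goodq : Good (turn q)) where

        -- The indices `p < r < q < n` lie within one turn of the cycle, so the three layers are
        -- distinct.
        load : ∀ {r} → p < r → r < q → s (turn p) + s (turn q) + s (turn r) ≤ δ * 2
        load {r} p<r r<q = ≤-trans
          (length-traces S′
            (turn-distinct p<q (<-≤-trans q<n (m≤n+m n p)))
            (turn-distinct p<r (<-≤-trans (<-trans r<q q<n) (m≤n+m n p)))
            (turn-distinct r<q (<-≤-trans q<n (m≤n+m n r)) ∘ sym))
          |S′|≤2δ

        δ*2≡ : δ * 2 ≡ δ + δ
        δ*2≡ = trans (*-comm δ 2) (cong (δ +_) (+-identityʳ δ))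

        -- The two heavy layers already account for the `2δ` vertices that `S` can have.
        empty : ∀ {r} → p < r → r < q → s (turn r) ≡ 0
        empty {r} p<r r<q = n≤0⇒n≡0 (+-cancelˡ-≤ (δ + δ) _ _ (begin
          δ + δ + s (turn r)                      ≤⟨ +-monoˡ-≤ _ (+-mono-≤ heavyp heavyq) ⟩
          s (turn p) + s (turn q) + s (turn r)    ≤⟨ load p<r r<q ⟩
          δ * 2                                   ≡⟨ trans δ*2≡ (sym (+-identityʳ _)) ⟩
          δ + δ + 0                               ∎))
          where open ≤-Reasoning

        -- Layer `q` takes `δ` of the `2δ` vertices. Layer `p` thus keeps a survivor, through which
        -- the gap is entered.
        s-p≤δ : ∀ {r} → p < r → r < q → s (turn p) ≤ δ
        s-p≤δ {r} p<r r<q = +-cancelʳ-≤ δ _ _ (begin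
          s (turn p) + δ                          ≤⟨ +-monoʳ-≤ _ heavyq ⟩
          s (turn p) + s (turn q)                 ≤⟨ m≤m+n _ _ ⟩
          s (turn p) + s (turn q) + s (turn r)    ≤⟨ load p<r r<q ⟩
          δ * 2                                   ≡⟨ δ*2≡ ⟩
          δ + δ                                   ∎)
          where open ≤-Reasoning

        -- Layers `p + 1` and `p + 2` are untouched by `S`, so they form a pair with loss `0 < κ`. A
        -- survivor `z` of layer `p` and its neighbour `z′` link the pair to `root`.
        Good-first : suc (suc p) < q → Good (turn (suc p))
        Good-first lt = Good-pair {turn (suc p)} {turn (suc (suc p))} (inj₁ (Succ-turn (suc p)))
          (subst₂ (λ x y → x + y < κ) (sym empty₁) (sym (empty (m≤n⇒m≤1+n ≤-refl) lt)) κ>0)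
          cz′ (inj₁ refl) z′∉S
          (Conn-step (goodp z cz z∉) (z∉ ∘ ∈S⇒∈tr) (zz′ , inj₁ (Succ-turn p)) z′∉S)
          (turn (suc p)) (inj₁ refl)
          where
          empty₁ : s (turn (suc p)) ≡ 0
          empty₁ = empty ≤-refl (<-trans ≤-refl lt)
          chosen : ∃ λ v → inComponent (v , turn p) ≡ true × v ∉ tr (turn p)
          chosen = survivor (turn p) (s-p≤δ ≤-refl (<-trans ≤-refl lt))
          z : V G
          z = proj₁ chosen
          cz : inComponent (z , turn p) ≡ true
          cz = proj₁ (proj₂ chosen)
          z∉ : z ∉ tr (turn p)
          z∉ = proj₂ (proj₂ chosen)
          z′ : V G
          z′ = proj₁ (neighbour z)
          zz′ : Adj G z z′
          zz′ = proj₂ (neighbour z)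
          cz′ : inComponent (z′ , turn (suc p)) ≡ true
          cz′ = component-closed {z , turn p} {z′ , turn (suc p)} (zz′ , inj₁ (Succ-turn p)) cz
          z′∉S : ((z′ , turn (suc p)) , cz′) ∉ S
          z′∉S z′∈S = <⇒≢ (∈-length (∈S⇒∈tr z′∈S)) (sym empty₁)

        -- Layers inside the gap are empty of `S`, hence not heavy as `δ > 0`, and nothing blocks
        -- the way up from layer `p + 1`.
        climb : suc (suc p) < q → ∀ k → p < k → k < q → Good (turn k)
        climb lt (suc k) p<sk sk<q = [ onward , (λ { refl → Good-first lt }) ]′ (m≤n⇒m<n∨m≡n (s≤s⁻¹ p<sk))
          where
          onward : p < k → Good (turn (suc k))
          onward p<k = Good-suc k (climb lt k p<k (<⇒≤ sk<q)) λ heavy →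
            n≮0 (<-≤-trans δ>0 (subst (δ ≤_) (empty p<k (<⇒≤ sk<q)) heavy))

        -- The only layers adjacent to the single one in the gap are `p` and `q`, both good.
        Good-middle : q ≡ suc (suc p) → Good (turn (suc p))
        Good-middle refl = Good-between λ j a →
          [ (λ eq → subst Good (sym eq) goodp) , (λ eq → subst Good (sym eq) goodq) ]′ (Cycle-neighbour p j a)

        Good-gap : ∀ k → p < k → k < q → Good (turn k)
        Good-gap k p<k k<q = byCases (suc (suc p) <? q)
          where
          byCases : Dec (suc (suc p) < q) → Good (turn k)
          byCases (yes lt) = climb lt k p<k k<q
          byCases (no ¬lt) = subst (Good ∘ turn) (≤-antisym p<k (s≤s⁻¹ (≤-trans k<q (≮⇒≥ ¬lt))))
            (Good-middle (≤-antisym (≮⇒≥ ¬lt) (≤-trans (s≤s p<k) k<q)))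

      -- One scan goes up from `0`, the other down from `n`, which is the same layer. If both are
      -- blocked, what they miss is the gap between the blocking layers.
      Good-all : ∀ k → k ≤ n → Good (turn k)
      Good-all = combine
        (scan (λ k → δ ≤? s (turn k)) n Good-0 (λ k _ → Good-suc k))
        (scan (λ k → δ ≤? s (turn (n ∸ k))) n (subst Good (sym turn-n) Good-0) Good-pred)
        where
        Good-pred : ∀ k → k < n → Good (turn (n ∸ k)) → ¬ Heavy (n ∸ k) → Good (turn (n ∸ suc k))
        Good-pred k k<n good ¬heavy = Good-next
          (inj₂ (subst (Succ n (turn (n ∸ suc k)) ∘ turn) (sym (+-∸-assoc 1 k<n)) (Succ-turn (n ∸ suc k))))
          good (≰⇒> ¬heavy)

        down : ∀ {q′} → (∀ k → k ≤ q′ → Good (turn (n ∸ k))) → ∀ k → k ≤ n → n ∸ q′ ≤ k → Good (turn k)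
        down {q′} good k k≤n q≤k = subst (Good ∘ turn) (m∸[m∸n]≡n k≤n)
          (good (n ∸ k) (m≤n+o⇒m∸n≤o n k (begin
            n               ≤⟨ m≤n+m∸n n q′ ⟩
            q′ + (n ∸ q′)   ≤⟨ +-monoʳ-≤ q′ q≤k ⟩
            q′ + k          ≡⟨ +-comm q′ k ⟩
            k + q′          ∎)))
          where open ≤-Reasoning

        combine :
          (∀ k → k ≤ n → Good (turn k)) ⊎ (∃ λ p → p < n × Heavy p × (∀ k → k ≤ p → Good (turn k))) →
          (∀ k → k ≤ n → Good (turn (n ∸ k))) ⊎
            (∃ λ q′ → q′ < n × Heavy (n ∸ q′) × (∀ k → k ≤ q′ → Good (turn (n ∸ k)))) →
          ∀ k → k ≤ n → Good (turn k)
        combine (inj₁ good) _ = good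
        combine (inj₂ _) (inj₁ good) k k≤n = down good k k≤n (≤-trans (≤-reflexive (n∸n≡0 n)) z≤n)
        combine (inj₂ (p , p<n , heavyp , goodp)) (inj₂ (q′ , q′<n , heavyq , goodq)) k k≤n
          = byCases (k ≤? p) (n ∸ q′ ≤? k)
          where
          -- A block at index `n` would make the base layer heavy, contrary to `light-0`.
          q<n : n ∸ q′ < n
          q<n = ≤∧≢⇒< (m∸n≤m n q′) λ q≡n →
            <⇒≱ light-0 (subst (λ i → δ ≤ s i) (trans (cong turn q≡n) turn-n) heavyq)

          byCases : Dec (k ≤ p) → Dec (n ∸ q′ ≤ k) → Good (turn k)
          byCases (yes k≤p) _ = goodp k k≤p
          byCases (no _) (yes q≤k) = down goodq k k≤n q≤k
          -- An index missed by both scans also witnesses `p < q`.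
          byCases (no k≰p) (no q≰k) = Gap.Good-gap (<-trans (≰⇒> k≰p) (≰⇒> q≰k)) q<n heavyp heavyq
            (goodp p ≤-refl) (goodq q′ ≤-refl) k (≰⇒> k≰p) (≰⇒> q≰k)

      everything-connected : ∀ x → x ∉ S → Conn x
      everything-connected ((v , i) , c) x∉S = located (turn-surjective i)
        where
        located : (∃ λ k → k ≤ n × turn k ≡ i) → Conn ((v , i) , c)
        located (k , k≤n , eq) = subst Good eq (Good-all k k≤n) v c (x∉S ∘ ∈tr⇒∈S c)

      -- The vertices that `S` separates are joined through `root`; the goal is empty, so the double
      -- negations can be opened.
      impossible : ⊥
      impossible =
        let _ , u , w , u∉S , w∉S , ¬uw = proj₁ minCut
        in everything-connected u u∉S λ ru → everything-connected w w∉S λ rw →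
           ¬uw (ReachIn-trans (ReachIn-sym ru) rw)

  superKappa : SuperKappa H
  superKappa S minCut = byCases (neighboursInS? minCut)
    where
    Isolated : V H → Set
    Isolated x = All (_∈ S) (proj₁ (H-neighbours x))

    byCases : Dec (Any Isolated H-vertices) → _
    byCases (yes found) = let x , _ , N⊆S = find found in isolated-suffices minCut x (All.lookup N⊆S)
    byCases (no none) = ⊥-elim (NoIsolated.impossible minCut escape)
      where
      escape : ∀ x → ∃ λ y → Adj H x y × y ∉ S
      escape x =
        let _ , _ , N⇔ , _ = H-neighbours x
            -- Decidability of membership in `S` turns the failure of `All` into an actual neighbour
            -- outside `S`.
            y , y∈N , y∉S = find (¬All⇒Any¬ (_∈? S) _ λ all → none (lose (∈-H-vertices x) all))
        in y , proj₁ (N⇔ y) y∈N , y∉S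

-- The two isomorphic components and the theorem

has-neighbour : ∀ {G : Graph} → Connected G → ∃₂ (Adj G) → ∀ v → ∃ (Adj G v)
has-neighbour conn (a , b , ab) v with conn v a
... | here     = b , ab
... | step e _ = _ , e

module TwoSides (G : Graph) (n : ℕ) (3≤n : 3 ≤ n) (2∣n : 2 ∣ n) (X : V G → Bool) (bip : IsBipartition G X) where

  open EvenCycle n 3≤n 2∣n

  -- The second component is the first one for the colouring with sides exchanged, so every result
  -- on `Layers` applies to both.
  coBip : IsBipartition G (not ∘ X)
  coBip u v uv = bip u v uv ∘ not-injective

  module A = Layers G n 3≤n 2∣n X bip
  module B = Layers G n 3≤n 2∣n (not ∘ X) coBip

  -- Reversing the cycle flips the parity of each layer and keeps the side of each vertex, so it
  -- exchanges the two components.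
  reflect : V (G ×ᵍ Cycle n) → V (G ×ᵍ Cycle n)
  reflect (v , i) = v , opposite i

  reflect-involutive : ∀ p → reflect (reflect p) ≡ p
  reflect-involutive (v , i) = cong (v ,_) (opposite-involutive i)

  reflect-Adj : ∀ {p q} → Adj (G ×ᵍ Cycle n) p q → Adj (G ×ᵍ Cycle n) (reflect p) (reflect q)
  reflect-Adj (uv , ij) = uv , opposite-Adj ij

  reflect-A→B : ∀ p → A.inComponent p ≡ true → B.inComponent (reflect p) ≡ true
  reflect-A→B (v , i) c = B.inComponent⁺ v (opposite i)
    (trans (cong not (A.inComponent⁻ v i c)) (sym (even-opposite i)))

  reflect-B→A : ∀ p → B.inComponent p ≡ true → A.inComponent (reflect p) ≡ true
  reflect-B→A (v , i) c = A.inComponent⁺ v (opposite i)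
    (trans (not-injective (trans (B.inComponent⁻ v i c) (sym (not-involutive _))))
           (sym (even-opposite i)))

  A≅B : ((G ×ᵍ Cycle n) [ A.inComponent ]) ≅ ((G ×ᵍ Cycle n) [ B.inComponent ])
  A≅B = mk↔ₛ′ (λ (p , c) → reflect p , reflect-A→B p c) (λ (p , c) → reflect p , reflect-B→A p c)
          (λ (p , _) → Sub-≡ B.inComponent (reflect-involutive p))
          (λ (p , _) → Sub-≡ A.inComponent (reflect-involutive p)) ,
        λ (p , _) (q , _) → reflect-Adj {p} {q} ,
          subst₂ (Adj (G ×ᵍ Cycle n)) (reflect-involutive p) (reflect-involutive q)
            ∘ reflect-Adj {reflect p} {reflect q}

  disjoint : ∀ p → A.inComponent p ≡ true → B.inComponent p ≡ true → ⊥
  disjoint (v , i) a b = not-¬ refl (trans (A.inComponent⁻ v i a) (sym (B.inComponent⁻ v i b)))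

  cover : ∀ p → A.inComponent p ≡ true ⊎ B.inComponent p ≡ true
  cover (v , i) with X v Bool.≟ even (toℕ i)
  ... | yes eq = inj₁ refl
  ... | no ¬eq = inj₂ (B.inComponent⁺ v i (sym (¬-not (¬eq ∘ sym))))

theorem3p6 : (G : Graph) → Finite G → Connected G
    → Σ (V G) (λ u → Σ (V G) (λ v → Adj G u v))
    → (X : V G → Bool) → IsBipartition G X
    → (n : ℕ) → 6 ≤ n → 2 ∣ n
    → Σ (V (G ×ᵍ Cycle n)) λ a → Σ (V (G ×ᵍ Cycle n)) λ b →
    Σ (V (G ×ᵍ Cycle n) → Bool) λ A → Σ (V (G ×ᵍ Cycle n) → Bool) λ B →
    IsComponentOf (G ×ᵍ Cycle n) a A
    × IsComponentOf (G ×ᵍ Cycle n) b B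
    × ¬ Reach (G ×ᵍ Cycle n) a b
    × (∀ w → Reach (G ×ᵍ Cycle n) a w ⊎ Reach (G ×ᵍ Cycle n) b w)
    × ((G ×ᵍ Cycle n) [ A ]) ≅ ((G ×ᵍ Cycle n) [ B ])
    × (∀ x y δ κ → HasSize (λ v → X v ≡ true) x → HasSize (λ v → X v ≡ false) y
    → MinDegree G δ → Connectivity G κ
    → suc δ ≤ x → suc δ ≤ y → 4 * δ < n * κ
    → SuperKappa ((G ×ᵍ Cycle n) [ A ]) × SuperKappa ((G ×ᵍ Cycle n) [ B ]))
theorem3p6 G fin conn edge X bip n 6≤n 2∣n =
  A.origin conn nbr x∈X , b , A.inComponent , B.inComponent ,
  A-isComponent , B-isComponent ,
  (λ r → disjoint b (proj₂ (A-isComponent b) r) (proj₂ (B-isComponent b) here)) ,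
  (λ w → [ inj₁ ∘ proj₁ (A-isComponent w) , inj₂ ∘ proj₁ (B-isComponent w) ]′ (cover w)) ,
  A≅B ,
  λ { _ _ δ κ (LX , uX , X⇔ , refl) (LY , uY , Y⇔ , refl) minDeg connectivity δ<x δ<y 4δ<nκ →
      let side : ∀ c → ∃ λ L → Unique L × (∀ {v} → v ∈ L → X v ≡ c) × δ < length L
          side = λ { true → LX , uX , proj₁ (X⇔ _) , δ<x ; false → LY , uY , proj₁ (Y⇔ _) , δ<y }
          -- Colour `c` under `not ∘ X` is colour `not c` under `X`.
          coSide : ∀ c → ∃ λ L → Unique L × (∀ {v} → v ∈ L → not (X v) ≡ c) × δ < length L
          coSide c = let L , uL , L⊆ , δ<L = side (not c)
                     in L , uL , (λ v∈ → trans (cong not (L⊆ v∈)) (not-involutive c)) , δ<L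
      in SuperConnected.superKappa G fin nbr n 3≤n 2∣n X bip δ κ side minDeg connectivity 4δ<nκ ,
         SuperConnected.superKappa G fin nbr n 3≤n 2∣n (not ∘ X) coBip δ κ coSide minDeg connectivity 4δ<nκ }
  where
  3≤n : 3 ≤ n
  3≤n = ≤-trans (s≤s (s≤s (s≤s z≤n))) 6≤n
  nbr : ∀ v → ∃ (Adj G v)
  nbr = has-neighbour {G} conn edge
  open TwoSides G n 3≤n 2∣n X bip
  -- The given edge has an end on each side, which yields an origin for each component.
  on-side : ∀ c → ∃ λ v → X v ≡ c
  on-side c = let u , v , uv = edge in byCases (X u Bool.≟ c)
    where
    byCases : Dec (X (proj₁ edge) ≡ c) → ∃ λ v → X v ≡ c
    byCases (yes eq) = _ , eq
    byCases (no ¬eq) = proj₁ (proj₂ edge) , trans (A.flip-side (proj₂ (proj₂ edge))) (sym (¬-not (¬eq ∘ sym)))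
  x∈X : X (proj₁ (on-side true)) ≡ true
  x∈X = proj₂ (on-side true)
  y∈Y : not (X (proj₁ (on-side false))) ≡ true
  y∈Y = cong not (proj₂ (on-side false))
  b : V (G ×ᵍ Cycle n)
  b = B.origin conn nbr y∈Y
  A-isComponent = A.inComponent-isComponent conn nbr x∈X
  B-isComponent = B.inComponent-isComponent conn nbr y∈Y
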